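{- Let $\Delta\ge 3$ be an integer and let $G$ be a finite simple graph such that either $\Delta=3$ and every node of $G$ has degree at most $3$, or $\Delta\ge 4$ and $G$ is $\Delta$-regular. Then every run of any min-degree greedy algorithm on $G$ (in particular MinGreedy, for every outcome of its random choices, and its deterministic variant with arbitrary tie-breaking) returns a matching $M$ with $|M|\ge \frac{\Delta-1}{2\Delta-3}\,\nu(G)$.
   Context: $\nu(G)$ denotes the size of a maximum matching of $G$. A min-degree greedy algorithm maintains a current graph (initially $G$) and a matching $M$ (initially empty); while the current graph has an edge, it chooses a node $u$ having minimum degree among the non-isolated nodes of the current graph, chooses any neighbor $v$ of $u$ in the current graph, adds $\{u,v\}$ to $M$, and deletes $u$, $v$ and all their incident edges; ties may be broken arbitrarily. MinGreedy is the variant in which $u$ is chosen uniformly at random among the non-isolated minimum-degree nodes and $v$ uniformly at random among the current neighbors of $u$. -}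

module Defs where

open import Data.Nat using (ℕ; zero; suc; _+_; _≤_; _<_)
open import Data.Bool using (Bool; true; false; _∧_; not; if_then_else_)
open import Data.Fin using (Fin; _≟_)
open import Data.List using (List; []; _∷_; map; length; allFin; concatMap)
open import Data.Nat.ListAction using (sum)
open import Data.List.Relation.Unary.All using (All)
open import Data.List.Relation.Unary.Unique.Propositional using (Unique)
open import Data.Product using (_×_; _,_)
open import Relation.Binary.PropositionalEquality using (_≡_)
open import Relation.Nullary.Decidable using (⌊_⌋)

record Graph (n : ℕ) : Set where
  field
    adj    : Fin n → Fin n → Bool
    adj-sym : ∀ u v → adj u v ≡ adj v u
    adj-irrefl : ∀ u → adj u u ≡ false
open Graph public

-- A vertex subset (the set of surviving vertices); the current graph is the
-- subgraph of G induced by it.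
VSet : ℕ → Set
VSet n = Fin n → Bool

allV : ∀ {n} → VSet n
allV _ = true

deg : ∀ {n} → Graph n → VSet n → Fin n → ℕ
deg {n} G S u = sum (map (λ v → if S v ∧ adj G u v then 1 else 0) (allFin n))

delete : ∀ {n} → VSet n → Fin n → Fin n → VSet n
delete S u v w = S w ∧ not ⌊ w ≟ u ⌋ ∧ not ⌊ w ≟ v ⌋

Edge : ∀ {n} → Graph n → VSet n → Fin n → Fin n → Set
Edge G S u v = (S u ≡ true) × (S v ≡ true) × (adj G u v ≡ true)

NoEdge : ∀ {n} → Graph n → VSet n → Set
NoEdge G S = ∀ u v → S u ≡ true → S v ≡ true → adj G u v ≡ false

MinDegNonIsolated : ∀ {n} → Graph n → VSet n → Fin n → Set
MinDegNonIsolated G S u =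
  ∀ w → S w ≡ true → 0 < deg G S w → deg G S u ≤ deg G S w

-- MinDegreeRun G S M : some run of a min-degree greedy algorithm (arbitrary
-- tie-breaking / arbitrary outcome of the random choices) started from the
-- current graph G[S] with empty matching returns the matching M.
data MinDegreeRun {n : ℕ} (G : Graph n) : VSet n → List (Fin n × Fin n) → Set where
  stop : ∀ {S} → NoEdge G S → MinDegreeRun G S []
  step : ∀ {S M} (u v : Fin n) →
         Edge G S u v →
         MinDegNonIsolated G S u →
         MinDegreeRun G (delete S u v) M →
         MinDegreeRun G S ((u , v) ∷ M)

endpoints : ∀ {n} → List (Fin n × Fin n) → List (Fin n)
endpoints = concatMap (λ { (u , v) → u ∷ v ∷ [] })

IsMatching : ∀ {n} → Graph n → List (Fin n × Fin n) → Set
IsMatching G N =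
  All (λ { (u , v) → adj G u v ≡ true }) N × Unique (endpoints N)

IsMaximumMatching : ∀ {n} → Graph n → List (Fin n × Fin n) → Set
IsMaximumMatching G N =
  IsMatching G N × (∀ N' → IsMatching G N' → length N' ≤ length N)

MaxDegreeAtMost : ∀ {n} → Graph n → ℕ → Set
MaxDegreeAtMost G d = ∀ u → deg G allV u ≤ d

Regular : ∀ {n} → Graph n → ℕ → Set
Regular G d = ∀ u → deg G allV u ≡ d

{-# OPTIONS --safe #-}
module Submission where

-- Regular case.  A step at a node of degree Δ leaves a node of degree strictly
-- between 0 and Δ, so at least every second step picks a node of degree below
-- Δ.  Hence a step removes on average at most 2Δ − 3/2 of the nΔ/2 edges, which
-- bounds n by (4 − 3/Δ)|M|, and |N| ≤ n/2 suffices.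
--
-- Maximum degree 3.  By induction on the run, the number of non-isolated nodes
-- is at most 3|M| + (ℓ ∸ 2), where ℓ is the number of leaves.  While the minimum
-- degree is 1, greedy is optimal: a vertex cover grows by one node per step.
-- Once there are no leaves, weight 1/2 on every non-isolated node completes it
-- to a fractional vertex cover of total weight at most 3|M|/2.

open import Defs
import Algebra.Properties.CommutativeMonoid.Sum
open import Data.Bool using (Bool; true; false; _∧_; not; if_then_else_)
open import Data.Fin using (Fin; zero; suc; _≟_)
open import Data.List using (List; []; _∷_; length; map; tabulate)
open import Data.List.Properties using (map-tabulate)
open import Data.List.Relation.Unary.All using (All; []; _∷_)
open import Data.List.Relation.Unary.AllPairs using ([]; _∷_)
open import Data.List.Relation.Unary.Unique.Propositional using (Unique)
open import Data.Nat hiding (_≟_)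
open import Data.Nat.ListAction using () renaming (sum to listSum)
open import Data.Nat.Properties hiding (_≟_)
open import Data.Nat.Tactic.RingSolver using (solve-∀)
open import Data.Product using (_×_; _,_; ∃-syntax; proj₁; proj₂)
open import Data.Sum using (_⊎_; inj₁; inj₂)
open import Function using (_∘_; id)
open import Relation.Binary.PropositionalEquality
open import Relation.Nullary using (yes; no; contradiction)
open import Relation.Nullary.Decidable using (⌊_⌋)
open Algebra.Properties.CommutativeMonoid.Sum +-0-commutativeMonoid
  using (sum; sum-cong-≗; ∑-distrib-+)

private variable
  n : ℕ

-- Finite sums over nodes and over sets of surviving nodes.

⟦_⟧ : Bool → ℕ
⟦ b ⟧ = if b then 1 else 0

sumOver : VSet n → (Fin n → ℕ) → ℕ
sumOver S f = sum (λ w → if S w then f w else 0)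

sum-tabulate : (f : Fin n → ℕ) → listSum (tabulate f) ≡ sum f
sum-tabulate {zero}  f = refl
sum-tabulate {suc n} f = cong (f zero +_) (sum-tabulate (f ∘ suc))

sum-mono : (f g : Fin n → ℕ) → (∀ w → f w ≤ g w) → sum f ≤ sum g
sum-mono {zero}  f g f≤g = z≤n
sum-mono {suc n} f g f≤g = +-mono-≤ (f≤g zero) (sum-mono (f ∘ suc) (g ∘ suc) (f≤g ∘ suc))

sum-zero : (f : Fin n → ℕ) → (∀ w → f w ≡ 0) → sum f ≡ 0
sum-zero {zero}  f f≡0 = refl
sum-zero {suc n} f f≡0 = cong₂ _+_ (f≡0 zero) (sum-zero (f ∘ suc) (f≡0 ∘ suc))

sum-const : ∀ n c → sum {n} (λ _ → c) ≡ n * c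
sum-const zero    c = refl
sum-const (suc n) c = cong (c +_) (sum-const n c)

sum-scale : ∀ c (f : Fin n → ℕ) → sum (λ w → c * f w) ≡ c * sum f
sum-scale {zero}  c f = sym (*-zeroʳ c)
sum-scale {suc n} c f =
  trans (cong (c * f zero +_) (sum-scale c (f ∘ suc))) (sym (*-distribˡ-+ c (f zero) (sum (f ∘ suc))))

sum-positive : (f : Fin n → ℕ) → 0 < sum f → ∃[ w ] 0 < f w
sum-positive {suc n} f 0<∑ with f zero in eq
... | suc _ = zero , subst (0 <_) (sym eq) z<s
... | zero with sum-positive (f ∘ suc) 0<∑
...   | w , 0<fw = suc w , 0<fw

-- The entry is set to 0 rather than removed, so the index type stays `Fin n` and extractions can be
-- iterated.
_without_ : (Fin n → ℕ) → Fin n → Fin n → ℕ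
(f without x) w = if not ⌊ w ≟ x ⌋ then f w else 0

≟-suc : (w x : Fin n) → ⌊ suc w ≟ suc x ⌋ ≡ ⌊ w ≟ x ⌋
≟-suc w x with w ≟ x
... | yes _ = refl
... | no  _ = refl

sum-extract : (f : Fin n → ℕ) (x : Fin n) → sum f ≡ f x + sum (f without x)
sum-extract {suc n} f zero    = refl
sum-extract {suc n} f (suc x) = begin
  f zero + sum (f ∘ suc)
    ≡⟨ cong (f zero +_) (sum-extract (f ∘ suc) x) ⟩
  f zero + (f (suc x) + sum ((f ∘ suc) without x))
    ≡⟨ swap (f zero) (f (suc x)) _ ⟩
  f (suc x) + (f zero + sum ((f ∘ suc) without x))
    ≡⟨ cong (λ s → f (suc x) + (f zero + s))
         (sum-cong-≗ (λ w → cong (λ b → if not b then f (suc w) else 0) (sym (≟-suc w x)))) ⟩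
  f (suc x) + sum (f without suc x) ∎
  where
  open ≡-Reasoning
  swap : ∀ a b c → a + (b + c) ≡ b + (a + c)
  swap = solve-∀

term≤sum : (f : Fin n → ℕ) (x : Fin n) → f x ≤ sum f
term≤sum f x = subst (f x ≤_) (sym (sum-extract f x)) (m≤m+n (f x) _)

without-≢ : (f : Fin n → ℕ) {x w : Fin n} → w ≢ x → (f without x) w ≡ f w
without-≢ f {x} {w} w≢x with w ≟ x
... | yes w≡x = contradiction w≡x w≢x
... | no  _   = refl

map-without : (f : Fin n → ℕ) {x : Fin n} {xs : List (Fin n)} →
              All (x ≢_) xs → map (f without x) xs ≡ map f xs
map-without f []         = refl
map-without f (x≢y ∷ x∉) = cong₂ _∷_ (without-≢ f (x≢y ∘ sym)) (map-without f x∉)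

-- The head is charged to `f x`; since `x` does not recur, the tail can be charged to `f without x`.
unique-sum≤ : (f : Fin n → ℕ) {xs : List (Fin n)} → Unique xs → listSum (map f xs) ≤ sum f
unique-sum≤ f {[]}     []          = z≤n
unique-sum≤ f {x ∷ xs} (x∉xs ∷ xs!) = begin
  f x + listSum (map f xs)             ≡⟨ cong (λ ys → f x + listSum ys) (sym (map-without f x∉xs)) ⟩
  f x + listSum (map (f without x) xs) ≤⟨ +-monoʳ-≤ (f x) (unique-sum≤ (f without x) xs!) ⟩
  f x + sum (f without x)              ≡⟨ sym (sum-extract f x) ⟩
  sum f                                ∎
  where open ≤-Reasoning

sumOver-mono : (S : VSet n) (f g : Fin n → ℕ) →
               (∀ w → S w ≡ true → f w ≤ g w) → sumOver S f ≤ sumOver S g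
sumOver-mono S f g f≤g = sum-mono _ _ pointwise
  where
  pointwise : ∀ w → (if S w then f w else 0) ≤ (if S w then g w else 0)
  pointwise w with S w in eq
  ... | true  = f≤g w eq
  ... | false = z≤n

sumOver-cong : (S : VSet n) (f g : Fin n → ℕ) →
               (∀ w → S w ≡ true → f w ≡ g w) → sumOver S f ≡ sumOver S g
sumOver-cong S f g f≡g = ≤-antisym (sumOver-mono S f g (λ w Sw → ≤-reflexive (f≡g w Sw)))
                                   (sumOver-mono S g f (λ w Sw → ≤-reflexive (sym (f≡g w Sw))))

sumOver-+ : (S : VSet n) (f g : Fin n → ℕ) →
            sumOver S (λ w → f w + g w) ≡ sumOver S f + sumOver S g
sumOver-+ S f g = trans (sum-cong-≗ pointwise) (∑-distrib-+ (λ w → if S w then f w else 0) (λ w → if S w then g w else 0))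
  where
  pointwise : ∀ w → (if S w then f w + g w else 0) ≡ (if S w then f w else 0) + (if S w then g w else 0)
  pointwise w with S w
  ... | true  = refl
  ... | false = refl

sumOver-scale : (S : VSet n) (c : ℕ) (f : Fin n → ℕ) →
                sumOver S (λ w → c * f w) ≡ c * sumOver S f
sumOver-scale S c f = trans (sum-cong-≗ pointwise) (sum-scale c (λ w → if S w then f w else 0))
  where
  pointwise : ∀ w → (if S w then c * f w else 0) ≡ c * (if S w then f w else 0)
  pointwise w with S w
  ... | true  = refl
  ... | false = sym (*-zeroʳ c)

term≤sumOver : (S : VSet n) (f : Fin n → ℕ) {x : Fin n} → S x ≡ true → f x ≤ sumOver S f
term≤sumOver S f {x} Sx =
  subst (λ b → (if b then f x else 0) ≤ sumOver S f) Sx (term≤sum (λ w → if S w then f w else 0) x)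

sumOver-positive : (S : VSet n) (f : Fin n → ℕ) → 0 < sumOver S f → ∃[ w ] S w ≡ true × 0 < f w
sumOver-positive S f 0<∑ with sum-positive _ 0<∑
... | w , 0<fw with S w in eq
...   | true = w , eq , 0<fw

delete⁻ : (S : VSet n) {u v w : Fin n} → delete S u v w ≡ true → S w ≡ true × w ≢ u × w ≢ v
delete⁻ S {u} {v} {w} S'w with S w | w ≟ u | w ≟ v
... | true | no w≢u | no w≢v = refl , w≢u , w≢v

delete⁺ : (S : VSet n) {u v w : Fin n} → S w ≡ true → w ≢ u → w ≢ v → delete S u v w ≡ true
delete⁺ S {u} {v} {w} Sw w≢u w≢v with w ≟ u | w ≟ v
... | yes w≡u | _       = contradiction w≡u w≢u
... | no _    | yes w≡v = contradiction w≡v w≢v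
... | no _    | no _    rewrite Sw = refl

-- `sum-extract` is applied at `u`, then at `v`; as `u ≢ v`, the first extraction leaves the entry
-- at `v` intact. The effect of a greedy step on degrees, degree sums and leaf counts is read off
-- from this splitting.
sumOver-delete : (S : VSet n) {u v : Fin n} → S u ≡ true → S v ≡ true → u ≢ v → (f : Fin n → ℕ) →
                 sumOver S f ≡ f u + f v + sumOver (delete S u v) f
sumOver-delete S {u} {v} Su Sv u≢v f = begin
  sum F                                                 ≡⟨ sum-extract F u ⟩
  F u + sum (F without u)                               ≡⟨ cong (F u +_) (sum-extract (F without u) v) ⟩
  F u + ((F without u) v + sum ((F without u) without v))
    ≡⟨ cong₂ (λ a s → a + s) (F≡f Su)
         (cong₂ _+_ (trans (without-≢ F (u≢v ∘ sym)) (F≡f Sv)) (sum-cong-≗ pointwise)) ⟩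
  f u + (f v + sumOver (delete S u v) f)                ≡⟨ sym (+-assoc (f u) (f v) _) ⟩
  f u + f v + sumOver (delete S u v) f                  ∎
  where
  open ≡-Reasoning
  F : Fin _ → ℕ
  F w = if S w then f w else 0
  F≡f : ∀ {w} → S w ≡ true → F w ≡ f w
  F≡f {w} Sw = cong (λ b → if b then f w else 0) Sw
  pointwise : ∀ w → ((F without u) without v) w ≡ (if delete S u v w then f w else 0)
  pointwise w with S w | w ≟ u | w ≟ v
  ... | true  | yes _ | yes _ = refl
  ... | true  | yes _ | no _  = refl
  ... | true  | no _  | yes _ = refl
  ... | true  | no _  | no _  = refl
  ... | false | yes _ | yes _ = refl
  ... | false | yes _ | no _  = refl
  ... | false | no _  | yes _ = refl
  ... | false | no _  | no _  = refl

-- Arithmetic of the degree changes in one greedy step.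

positive isOne : ℕ → ℕ
positive zero    = 0
positive (suc _) = 1
isOne (suc zero) = 1
isOne _          = 0

-- 1 if a node of remaining degree δ that lost c edges has become isolated.
vanishes : ℕ → ℕ → ℕ
vanishes zero    c = positive c
vanishes (suc _) c = 0

positive≤1 : ∀ m → positive m ≤ 1
positive≤1 zero    = z≤n
positive≤1 (suc _) = ≤-refl

positive≥1 : ∀ {m} → 0 < m → 1 ≤ positive m
positive≥1 {suc _} _ = ≤-refl

positive-+ : ∀ δ c → positive (δ + c) ≡ positive δ + vanishes δ c
positive-+ zero    c = refl
positive-+ (suc δ) c = refl

isOne⇒≡1 : ∀ m → 0 < isOne m → m ≡ 1
isOne⇒≡1 (suc zero) _ = refl

one-or-more : ∀ m → 0 < m → m ≡ 1 ⊎ ∃[ k ] m ≡ 2 + k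
one-or-more (suc zero)    _ = inj₁ refl
one-or-more (suc (suc k)) _ = inj₂ (k , refl)

-- Every lost edge pays one unit. A new leaf costs one unit and a newly isolated node two; a node
-- isolated by a single loss was a leaf, which supplies the second unit.
isOne-vanishes : ∀ δ c → isOne δ + 2 * vanishes δ c ≤ isOne (δ + c) + c
isOne-vanishes zero          zero          = z≤n
isOne-vanishes zero          (suc zero)    = ≤-refl
isOne-vanishes zero          (suc (suc c)) = s≤s (s≤s z≤n)
isOne-vanishes (suc zero)    zero          = ≤-refl
isOne-vanishes (suc zero)    (suc c)       = s≤s z≤n
isOne-vanishes (suc (suc δ)) c             = z≤n

-- A node that becomes isolated has lost its whole degree, which is at least `d` by `large`, the
-- form in which minimality of the chosen degree enters.
vanishes-scaled : ∀ d δ c → (0 < δ + c → d ≤ δ + c) → d * vanishes δ c ≤ c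
vanishes-scaled d zero    zero    large = ≤-reflexive (*-zeroʳ d)
vanishes-scaled d zero    (suc c) large = ≤-trans (≤-reflexive (*-identityʳ d)) (large z<s)
vanishes-scaled d (suc δ) c       large = ≤-trans (≤-reflexive (*-zeroʳ d)) z≤n

-- From a degree of at least `suc d`, ending at 0 or 1 takes at least `d` losses. The two outcomes
-- exclude each other, so one charge of `d` serves both.
vanishes-isOne-scaled : ∀ d δ c → (0 < δ + c → suc d ≤ δ + c) → d * (vanishes δ c + isOne δ) ≤ c
vanishes-isOne-scaled d zero zero    large = ≤-reflexive (*-zeroʳ d)
vanishes-isOne-scaled d zero (suc c) large = ≤-trans (≤-reflexive (*-identityʳ d)) (≤-trans (n≤1+n d) (large z<s))
vanishes-isOne-scaled d (suc zero)    c large = ≤-trans (≤-reflexive (*-identityʳ d)) (≤-pred (large z<s))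
vanishes-isOne-scaled d (suc (suc δ)) c large = ≤-trans (≤-reflexive (*-zeroʳ d)) z≤n

-- The split on `i` handles the truncated subtraction: for `i ≥ 2` the hypothesis forces `ℓ ≥ 3`, so
-- `ℓ ∸ 2` is a true difference there.
leaf-arithmetic : ∀ i ℓ′ ℓ → ℓ′ + 2 * i ≤ suc ℓ → i + (ℓ′ ∸ 2) ≤ 1 + (ℓ ∸ 2)
leaf-arithmetic zero ℓ′ ℓ h = begin
  ℓ′ ∸ 2      ≤⟨ ∸-monoˡ-≤ 2 (subst (_≤ suc ℓ) (+-identityʳ ℓ′) h) ⟩
  suc ℓ ∸ 2   ≤⟨ suc-∸ ℓ ⟩
  1 + (ℓ ∸ 2) ∎
  where
  open ≤-Reasoning
  suc-∸ : ∀ m → suc m ∸ 2 ≤ 1 + (m ∸ 2)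
  suc-∸ zero          = z≤n
  suc-∸ (suc zero)    = z≤n
  suc-∸ (suc (suc m)) = ≤-refl
leaf-arithmetic (suc zero) ℓ′ ℓ h =
  s≤s (∸-monoˡ-≤ 2 (≤-trans (m≤m+n ℓ′ 1) (≤-pred (subst (_≤ suc ℓ) (+-suc ℓ′ 1) h))))
leaf-arithmetic (suc (suc i)) ℓ′ ℓ h = begin
  2 + i + (ℓ′ ∸ 2)       ≤⟨ +-monoʳ-≤ (2 + i) (m∸n≤m ℓ′ 2) ⟩
  2 + i + ℓ′             ≤⟨ m≤m+n _ i ⟩
  2 + i + ℓ′ + i         ≡⟨ regroup i ℓ′ ⟩
  1 + (1 + 2 * i + ℓ′)   ≤⟨ s≤s (m+n≤o⇒m≤o∸n _ (≤-pred (subst (_≤ suc ℓ) (expand i ℓ′) h))) ⟩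
  1 + (ℓ ∸ 2)            ∎
  where
  open ≤-Reasoning
  regroup : ∀ i ℓ → 2 + i + ℓ + i ≡ 1 + (1 + 2 * i + ℓ)
  regroup = solve-∀
  expand : ∀ i ℓ → ℓ + 2 * (2 + i) ≡ suc (1 + 2 * i + ℓ + 2)
  expand = solve-∀

scaled-bound : ∀ {d b m} c → d * m ≤ b → b < d * suc c → m ≤ c
scaled-bound {d} {b} {m} c dm≤b b<d = ≤-pred (*-cancelˡ-< d m (suc c) (≤-<-trans dm≤b b<d))

-- Here `2 + k` is the minimum degree and `3 + k` bounds the lost edge ends. Both `2 (2 + k)` and
-- `4 (1 + k)` exceed `3 + k`, so integrality gives `i ≤ 1` and `i + ℓ ≤ 3`.
nonleaf-arithmetic : ∀ k i ℓ → (2 + k) * i ≤ 3 + k → (1 + k) * (i + ℓ) ≤ 3 + k → i + (ℓ ∸ 2) ≤ 1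
nonleaf-arithmetic k i ℓ hi hℓ = go ℓ i≤1 i+ℓ≤3
  where
  expand₁ : ∀ k → (2 + k) * 2 ≡ suc (3 + k) + k
  expand₁ = solve-∀
  expand₂ : ∀ k → (1 + k) * 4 ≡ suc (3 + k) + 3 * k
  expand₂ = solve-∀
  i≤1 : i ≤ 1
  i≤1 = scaled-bound {2 + k} 1 hi (subst (3 + k <_) (sym (expand₁ k)) (m≤m+n _ k))
  i+ℓ≤3 : i + ℓ ≤ 3
  i+ℓ≤3 = scaled-bound {1 + k} 3 hℓ (subst (3 + k <_) (sym (expand₂ k)) (m≤m+n _ (3 * k)))
  go : ∀ ℓ → i ≤ 1 → i + ℓ ≤ 3 → i + (ℓ ∸ 2) ≤ 1
  go zero          i≤1 _ = subst (_≤ 1) (sym (+-identityʳ i)) i≤1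
  go (suc zero)    i≤1 _ = subst (_≤ 1) (sym (+-identityʳ i)) i≤1
  go (suc (suc ℓ)) _   h = ≤-pred (≤-pred (subst (_≤ 3) (trans (+-suc i (suc ℓ)) (cong suc (+-suc i ℓ))) h))

-- Degrees when the two ends of an edge are deleted.

module _ (G : Graph n) where

  deg-sumOver : ∀ S u → deg G S u ≡ sumOver S (λ v → ⟦ adj G u v ⟧)
  deg-sumOver S u = begin
    deg G S u                                          ≡⟨ cong listSum (map-tabulate id (λ v → ⟦ S v ∧ adj G u v ⟧)) ⟩
    listSum (tabulate (λ v → ⟦ S v ∧ adj G u v ⟧))      ≡⟨ sum-tabulate (λ v → ⟦ S v ∧ adj G u v ⟧) ⟩
    sum (λ v → ⟦ S v ∧ adj G u v ⟧)                     ≡⟨ sum-cong-≗ pointwise ⟩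
    sumOver S (λ v → ⟦ adj G u v ⟧)                     ∎
    where
    open ≡-Reasoning
    pointwise : ∀ v → ⟦ S v ∧ adj G u v ⟧ ≡ (if S v then ⟦ adj G u v ⟧ else 0)
    pointwise v with S v
    ... | true  = refl
    ... | false = refl

  edge-≢ : ∀ {S u v} → Edge G S u v → u ≢ v
  edge-≢ {u = u} (_ , _ , uv) refl with trans (sym uv) (adj-irrefl G u)
  ... | ()

  edge-sym : ∀ {S u v} → Edge G S u v → Edge G S v u
  edge-sym {u = u} {v} (Su , Sv , uv) = Sv , Su , trans (adj-sym G v u) uv

  edge⇒deg>0 : ∀ {S u v} → Edge G S u v → 0 < deg G S u
  edge⇒deg>0 {S} {u} {v} (_ , Sv , uv) = begin-strict
    0                                     <⟨ z<s ⟩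
    1                                     ≡⟨ cong ⟦_⟧ (sym uv) ⟩
    ⟦ adj G u v ⟧                         ≤⟨ term≤sumOver S (λ w → ⟦ adj G u w ⟧) Sv ⟩
    sumOver S (λ w → ⟦ adj G u w ⟧)       ≡⟨ sym (deg-sumOver S u) ⟩
    deg G S u                             ∎
    where open ≤-Reasoning

  noEdge⇒deg≡0 : ∀ {S u} → NoEdge G S → S u ≡ true → deg G S u ≡ 0
  noEdge⇒deg≡0 {S} {u} noE Su = trans (deg-sumOver S u)
    (trans (sumOver-cong S _ (λ _ → 0) (λ w Sw → cong ⟦_⟧ (noE u w Su Sw)))
      (sum-zero _ (λ w → zeros (S w))))
    where
    zeros : ∀ b → (if b then 0 else 0) ≡ 0
    zeros true  = refl
    zeros false = refl

  deg≤deg-allV : ∀ S u → deg G S u ≤ deg G allV u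
  deg≤deg-allV S u = begin
    deg G S u                              ≡⟨ deg-sumOver S u ⟩
    sumOver S (λ v → ⟦ adj G u v ⟧)        ≤⟨ sum-mono _ _ pointwise ⟩
    sumOver allV (λ v → ⟦ adj G u v ⟧)     ≡⟨ sym (deg-sumOver allV u) ⟩
    deg G allV u                           ∎
    where
    open ≤-Reasoning
    pointwise : ∀ v → (if S v then ⟦ adj G u v ⟧ else 0) ≤ ⟦ adj G u v ⟧
    pointwise v with S v
    ... | true  = ≤-refl
    ... | false = z≤n

  lostDegree : Fin n → Fin n → Fin n → ℕ
  lostDegree u v w = ⟦ adj G u w ⟧ + ⟦ adj G v w ⟧

  deg-delete : ∀ {S u v} → Edge G S u v → ∀ w →
               deg G S w ≡ deg G (delete S u v) w + lostDegree u v w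
  deg-delete {S} {u} {v} e@(Su , Sv , _) w = begin
    deg G S w                                                  ≡⟨ deg-sumOver S w ⟩
    sumOver S (λ x → ⟦ adj G w x ⟧)                            ≡⟨ sumOver-delete S Su Sv (edge-≢ e) _ ⟩
    ⟦ adj G w u ⟧ + ⟦ adj G w v ⟧ + sumOver (delete S u v) (λ x → ⟦ adj G w x ⟧)
      ≡⟨ cong₂ _+_ (cong₂ (λ a b → ⟦ a ⟧ + ⟦ b ⟧) (adj-sym G w u) (adj-sym G w v))
           (sym (deg-sumOver (delete S u v) w)) ⟩
    lostDegree u v w + deg G (delete S u v) w                  ≡⟨ +-comm (lostDegree u v w) _ ⟩
    deg G (delete S u v) w + lostDegree u v w                  ∎
    where open ≡-Reasoning

  deg-endpointˡ : ∀ {S u v} → Edge G S u v →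
                 deg G S u ≡ suc (sumOver (delete S u v) (λ w → ⟦ adj G u w ⟧))
  deg-endpointˡ {S} {u} {v} e@(Su , Sv , uv) = begin
    deg G S u                                                  ≡⟨ deg-sumOver S u ⟩
    sumOver S (λ x → ⟦ adj G u x ⟧)                            ≡⟨ sumOver-delete S Su Sv (edge-≢ e) _ ⟩
    ⟦ adj G u u ⟧ + ⟦ adj G u v ⟧ + sumOver (delete S u v) (λ x → ⟦ adj G u x ⟧)
      ≡⟨ cong₂ (λ a b → ⟦ a ⟧ + ⟦ b ⟧ + sumOver (delete S u v) (λ x → ⟦ adj G u x ⟧)) (adj-irrefl G u) uv ⟩
    suc (sumOver (delete S u v) (λ w → ⟦ adj G u w ⟧))         ∎
    where open ≡-Reasoning

  deg-endpointʳ : ∀ {S u v} → Edge G S u v →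
                  deg G S v ≡ suc (sumOver (delete S u v) (λ w → ⟦ adj G v w ⟧))
  deg-endpointʳ {S} {u} {v} e@(Su , Sv , uv) = begin
    deg G S v                                                  ≡⟨ deg-sumOver S v ⟩
    sumOver S (λ x → ⟦ adj G v x ⟧)                            ≡⟨ sumOver-delete S Su Sv (edge-≢ e) _ ⟩
    ⟦ adj G v u ⟧ + ⟦ adj G v v ⟧ + sumOver (delete S u v) (λ x → ⟦ adj G v x ⟧)
      ≡⟨ cong₂ (λ a b → ⟦ a ⟧ + ⟦ b ⟧ + sumOver (delete S u v) (λ x → ⟦ adj G v x ⟧))
           (trans (adj-sym G v u) uv) (adj-irrefl G v) ⟩
    suc (sumOver (delete S u v) (λ w → ⟦ adj G v w ⟧))         ∎
    where open ≡-Reasoning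

  -- The 2 stands for the two ends of the edge `uv` itself, which no survivor sees.
  sum-lostDegree : ∀ {S u v} → Edge G S u v →
                   2 + sumOver (delete S u v) (lostDegree u v) ≡ deg G S u + deg G S v
  sum-lostDegree {S} {u} {v} e = begin
    2 + sumOver S′ (lostDegree u v)       ≡⟨ cong (2 +_) (sumOver-+ S′ _ _) ⟩
    2 + (A + B)                           ≡⟨ cong suc (sym (+-suc A B)) ⟩
    suc A + suc B                         ≡⟨ cong₂ _+_ (sym (deg-endpointˡ e)) (sym (deg-endpointʳ e)) ⟩
    deg G S u + deg G S v                 ∎
    where
    open ≡-Reasoning
    S′ : VSet n
    S′ = delete S u v
    A B : ℕ
    A = sumOver S′ (λ w → ⟦ adj G u w ⟧)
    B = sumOver S′ (λ w → ⟦ adj G v w ⟧)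

  -- Weak duality: y / 2 is a fractional vertex cover.
  matching≤cover : (y : Fin n → ℕ) → (∀ u v → adj G u v ≡ true → 2 ≤ y u + y v) →
                   ∀ N → IsMatching G N → 2 * length N ≤ sum y
  matching≤cover y cover N (edges , unique) = ≤-trans (weight N edges) (unique-sum≤ y unique)
    where
    open ≤-Reasoning
    weight : ∀ N → All _ N → 2 * length N ≤ listSum (map y (endpoints N))
    weight []            []       = z≤n
    weight ((u , v) ∷ N) (e ∷ es) = begin
      2 * suc (length N)                           ≡⟨ *-suc 2 (length N) ⟩
      2 + 2 * length N                             ≤⟨ +-mono-≤ (cover u v e) (weight N es) ⟩
      y u + y v + listSum (map y (endpoints N))    ≡⟨ +-assoc (y u) (y v) _ ⟩
      y u + (y v + listSum (map y (endpoints N)))  ∎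

  -- Degree sums and the regular case.

  degreeSum : VSet n → ℕ
  degreeSum S = sumOver S (deg G S)

  -- The step removes `deg u + deg v - 1` edges, as `uv` is counted from both ends, and each edge
  -- counts twice in the degree sum. The 2 stands on the left to avoid truncated subtraction.
  degreeSum-delete : ∀ {S u v} → Edge G S u v →
                     2 + degreeSum S ≡ degreeSum (delete S u v) + 2 * (deg G S u + deg G S v)
  degreeSum-delete {S} {u} {v} e@(Su , Sv , _) = begin
    2 + degreeSum S                                  ≡⟨ cong (2 +_) (sumOver-delete S Su Sv (edge-≢ e) (deg G S)) ⟩
    2 + (d + sumOver S′ (deg G S))                   ≡⟨ cong (λ s → 2 + (d + s)) (sumOver-cong S′ _ _ (λ w _ → deg-delete e w)) ⟩
    2 + (d + sumOver S′ (λ w → deg G S′ w + lostDegree u v w))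
                                                     ≡⟨ cong (λ s → 2 + (d + s)) (sumOver-+ S′ _ _) ⟩
    2 + (d + (degreeSum S′ + sumOver S′ (lostDegree u v)))
                                                     ≡⟨ regroup d (degreeSum S′) _ ⟩
    degreeSum S′ + (d + (2 + sumOver S′ (lostDegree u v)))
                                                     ≡⟨ cong (λ s → degreeSum S′ + (d + s)) (sum-lostDegree e) ⟩
    degreeSum S′ + (d + d)                           ≡⟨ double (degreeSum S′) d ⟩
    degreeSum S′ + 2 * d                             ∎
    where
    open ≡-Reasoning
    S′ : VSet n
    S′ = delete S u v
    d : ℕ
    d = deg G S u + deg G S v
    regroup : ∀ a b c → 2 + (a + (b + c)) ≡ b + (a + (2 + c))
    regroup = solve-∀
    double : ∀ a b → a + (b + b) ≡ a + 2 * b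
    double = solve-∀

  degreeSum-noEdge : ∀ {S} → NoEdge G S → degreeSum S ≡ 0
  degreeSum-noEdge {S} noE = n≤0⇒n≡0 (≮⇒≥ λ 0<D →
    let w , Sw , 0<deg = sumOver-positive S (deg G S) 0<D
    in <-irrefl (sym (noEdge⇒deg≡0 noE Sw)) 0<deg)

  another-neighbour : ∀ {S u v} → Edge G S u v → 1 < deg G S u →
                      ∃[ w ] delete S u v w ≡ true × adj G u w ≡ true
  another-neighbour {S} {u} {v} e 1<deg
    with sumOver-positive (delete S u v) (λ w → ⟦ adj G u w ⟧) (≤-pred (subst (1 <_) (deg-endpointˡ e) 1<deg))
  ... | w , S′w , 0<uw with adj G u w in uw
  ...   | true = w , S′w , uw

  ⟦⟧≤1 : ∀ b → ⟦ b ⟧ ≤ 1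
  ⟦⟧≤1 true  = ≤-refl
  ⟦⟧≤1 false = z≤n

  module _ (d : ℕ) (2≤d : 2 ≤ d) (maxDeg : MaxDegreeAtMost G (suc d)) where

    private
      -- With `Δ = suc d` this is `4 Δ - 3`, the degree-sum allowance per step. A step at degree `Δ`
      -- exceeds it by at most one; a step at lower degree stays at least one below it.
      K : ℕ
      K = suc (4 * d)

    -- Such a node forces the next greedy choice to have degree at most `d`, however ties are
    -- broken.
    Low : VSet n → Set
    Low S = ∃[ w ] S w ≡ true × 0 < deg G S w × deg G S w ≤ d

    step-bound : ∀ {S u v a} → Edge G S u v → deg G S u ≤ a →
                 2 + degreeSum S ≤ degreeSum (delete S u v) + 2 * (a + suc d)
    step-bound {S} {u} {v} {a} e du≤a = subst (_≤ D′ + 2 * (a + suc d)) (sym (degreeSum-delete e))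
      (+-monoʳ-≤ D′ (*-monoʳ-≤ 2 (+-mono-≤ du≤a (≤-trans (deg≤deg-allV S v) (maxDeg v)))))
      where
      D′ : ℕ
      D′ = degreeSum (delete S u v)

    -- The drop is at most `2 (d + suc d) - 2 = K - 1`; the saved unit is the strictness of the
    -- conclusion.
    low-step : ∀ {S u v μ} → Edge G S u v → deg G S u ≤ d →
               degreeSum (delete S u v) ≤ K * μ → degreeSum S < K * suc μ
    low-step {S} {u} {v} {μ} e du≤d D′≤ = ≤-pred (begin
      2 + degreeSum S          ≤⟨ step-bound e du≤d ⟩
      D′ + 2 * (d + suc d)     ≡⟨ regroup D′ d ⟩
      suc (K + D′)             ≤⟨ s≤s (+-monoʳ-≤ K D′≤) ⟩
      suc (K + K * μ)          ≡⟨ cong suc (sym (*-suc K μ)) ⟩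
      suc (K * suc μ)          ∎)
      where
      open ≤-Reasoning
      D′ : ℕ
      D′ = degreeSum (delete S u v)
      regroup : ∀ a d → a + 2 * (d + suc d) ≡ suc (suc (4 * d) + a)
      regroup = solve-∀

    mutual
      -- Mutual induction on the run. A step at degree `suc d` may overspend by one but leaves a
      -- `Low` node, so the strict bound for the remaining run returns that unit.
      degreeSum≤ : ∀ {S M} → MinDegreeRun G S M → degreeSum S ≤ K * length M
      degreeSum≤ (stop noE) = ≤-trans (≤-reflexive (degreeSum-noEdge noE)) z≤n
      degreeSum≤ {S} {_ ∷ M} (step u v e min run) with deg G S u ≤? d
      ... | yes du≤d = <⇒≤ (low-step e du≤d (degreeSum≤ run))
      ... | no  du≰d = ≤-pred (≤-pred (begin
        2 + degreeSum S                            ≤⟨ step-bound e (≤-trans (deg≤deg-allV S u) (maxDeg u)) ⟩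
        D′ + 2 * (suc d + suc d)                   ≡⟨ regroup D′ d ⟩
        2 + (suc D′ + K)                           ≤⟨ +-monoʳ-≤ 2 (+-monoˡ-≤ K (degreeSum< run low)) ⟩
        2 + (K * length M + K)                     ≡⟨ cong (2 +_) (trans (+-comm (K * length M) K) (sym (*-suc K (length M)))) ⟩
        2 + K * suc (length M)                     ∎))
        where
        open ≤-Reasoning
        S′ : VSet n
        S′ = delete S u v
        D′ : ℕ
        D′ = degreeSum S′
        regroup : ∀ a d → a + 2 * (suc d + suc d) ≡ 2 + (suc a + suc (4 * d))
        regroup = solve-∀
        d<du : d < deg G S u
        d<du = ≰⇒> du≰d
        -- The witness is a neighbour `w` of `u` other than `v`. Minimality of `deg u = suc d` gives
        -- `w` the same degree; it loses one or two edges, and `2 ≤ d` keeps the rest between 1 and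
        -- `d`.
        low : Low S′
        low with another-neighbour e (≤-trans (s≤s (≤-trans (n≤1+n 1) 2≤d)) d<du)
        ... | w , S′w , uw = w , S′w , 0<d′ , d′≤d
          where
          Sw : S w ≡ true
          Sw = proj₁ (delete⁻ S S′w)
          lost : ℕ
          lost = lostDegree u v w
          lost≡ : lost ≡ suc ⟦ adj G v w ⟧
          lost≡ = cong (λ b → ⟦ b ⟧ + ⟦ adj G v w ⟧) uw
          suc-d≤ : suc d ≤ deg G S′ w + lost
          suc-d≤ = subst (suc d ≤_) (deg-delete e w)
            (≤-trans d<du (min w Sw (edge⇒deg>0 {v = u} (Sw , proj₁ e , trans (adj-sym G w u) uw))))
          0<d′ : 0 < deg G S′ w
          0<d′ = +-cancelʳ-≤ 2 1 (deg G S′ w) (≤-trans (s≤s 2≤d) (≤-trans suc-d≤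
            (+-monoʳ-≤ (deg G S′ w) (subst (_≤ 2) (sym lost≡) (s≤s (⟦⟧≤1 _))))))
          d′≤d : deg G S′ w ≤ d
          d′≤d = ≤-pred (begin
            suc (deg G S′ w)                    ≤⟨ s≤s (m≤m+n _ ⟦ adj G v w ⟧) ⟩
            suc (deg G S′ w + ⟦ adj G v w ⟧)    ≡⟨ sym (+-suc (deg G S′ w) _) ⟩
            deg G S′ w + suc ⟦ adj G v w ⟧      ≡⟨ cong (deg G S′ w +_) (sym lost≡) ⟩
            deg G S′ w + lost                   ≡⟨ sym (deg-delete e w) ⟩
            deg G S w                           ≤⟨ deg≤deg-allV S w ⟩
            deg G allV w                        ≤⟨ maxDeg w ⟩
            suc d                               ∎)

      degreeSum< : ∀ {S M} → MinDegreeRun G S M → Low S → degreeSum S < K * length M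
      degreeSum< (stop noE) (w , Sw , 0<deg , _) = contradiction (noEdge⇒deg≡0 noE Sw) (>⇒≢ 0<deg)
      degreeSum< (step u v e min run) (w , Sw , 0<deg , deg≤d) =
        low-step e (≤-trans (min w Sw 0<deg) deg≤d) (degreeSum≤ run)

  -- Regularity makes the degree sum `n Δ`, and constant weight 1, read as one half per node, gives
  -- `2 ν ≤ n`. Multiplying both sides by `2 Δ` avoids division.
  regular-bound : ∀ d → 2 ≤ d → Regular G (suc d) → ∀ M N → MinDegreeRun G allV M → IsMatching G N →
                  d * length N ≤ (2 * suc d ∸ 3) * length M
  regular-bound (suc zero) (s≤s ())
  regular-bound d@(suc (suc k)) 2≤d reg M N run matching = *-cancelˡ-≤ (2 * Δ) (begin
    2 * Δ * (d * ν)             ≡⟨ lhs d ν ⟩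
    d * (Δ * (2 * ν))           ≤⟨ *-monoʳ-≤ d (*-monoʳ-≤ Δ (subst (2 * ν ≤_) (trans (sum-const n 1) (*-identityʳ n))
                                     (matching≤cover (λ _ → 1) (λ _ _ _ → ≤-refl) N matching))) ⟩
    d * (Δ * n)                 ≡⟨ cong (d *_) (trans (*-comm Δ n) (sym degreeSum≡)) ⟩
    d * degreeSum allV          ≤⟨ *-monoʳ-≤ d (degreeSum≤ d 2≤d (≤-reflexive ∘ reg) run) ⟩
    -- The slack `2 Δ (2 Δ - 3) - d (4 d + 1)` equals `k`, that is `Δ - 3`.
    d * (suc (4 * d) * μ)       ≤⟨ m≤m+n _ (k * μ) ⟩
    d * (suc (4 * d) * μ) + k * μ  ≡⟨ rhs k μ ⟩
    2 * Δ * ((3 + 2 * k) * μ)   ≡⟨ cong (λ a → 2 * Δ * (a * μ)) (sym (cong (_∸ 3) (coefficient k))) ⟩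
    2 * Δ * ((2 * Δ ∸ 3) * μ)   ∎)
    where
    open ≤-Reasoning
    Δ ν μ : ℕ
    Δ = suc d
    ν = length N
    μ = length M
    degreeSum≡ : degreeSum allV ≡ n * Δ
    degreeSum≡ = trans (sumOver-cong allV _ (λ _ → Δ) (λ w _ → reg w)) (sum-const n Δ)
    lhs : ∀ d ν → 2 * suc d * (d * ν) ≡ d * (suc d * (2 * ν))
    lhs = solve-∀
    rhs : ∀ k μ → (2 + k) * (suc (4 * (2 + k)) * μ) + k * μ ≡ 2 * (3 + k) * ((3 + 2 * k) * μ)
    rhs = solve-∀
    coefficient : ∀ k → 2 * (3 + k) ≡ 3 + (3 + 2 * k)
    coefficient = solve-∀

  -- Maximum degree three: counting non-isolated nodes and leaves.

  nonIsolated leaves : VSet n → ℕ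
  nonIsolated S = sumOver S (λ w → positive (deg G S w))
  leaves S      = sumOver S (λ w → isOne (deg G S w))

  newlyIsolated : VSet n → Fin n → Fin n → ℕ
  newlyIsolated S u v = sumOver S′ (λ w → vanishes (deg G S′ w) (lostDegree u v w))
    where
    S′ : VSet n
    S′ = delete S u v

  -- By `positive-+`, a survivor that had an edge either keeps one or is newly isolated; the 2
  -- accounts for `u` and `v`.
  nonIsolated-delete : ∀ {S u v} → Edge G S u v →
                       nonIsolated S ≤ 2 + (nonIsolated (delete S u v) + newlyIsolated S u v)
  nonIsolated-delete {S} {u} {v} e@(Su , Sv , _) = begin
    nonIsolated S
      ≡⟨ sumOver-delete S Su Sv (edge-≢ e) _ ⟩
    positive (deg G S u) + positive (deg G S v) + sumOver S′ (λ w → positive (deg G S w))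
      ≤⟨ +-mono-≤ (+-mono-≤ (positive≤1 (deg G S u)) (positive≤1 (deg G S v)))
           (≤-reflexive (sumOver-cong S′ _ _ (λ w _ →
             trans (cong positive (deg-delete e w)) (positive-+ (deg G S′ w) (lostDegree u v w))))) ⟩
    2 + sumOver S′ (λ w → positive (deg G S′ w) + vanishes (deg G S′ w) (lostDegree u v w))
      ≡⟨ cong (2 +_) (sumOver-+ S′ _ _) ⟩
    2 + (nonIsolated S′ + newlyIsolated S u v) ∎
    where
    open ≤-Reasoning
    S′ : VSet n
    S′ = delete S u v

  -- A second neighbour would survive the deletion, but `deg-endpointˡ` leaves `u` no surviving
  -- neighbour when its degree is 1.
  leaf-neighbour : ∀ {S u v w} → Edge G S u v → Edge G S u w → deg G S u ≡ 1 → w ≡ v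
  leaf-neighbour {S} {u} {v} {w} e f@(_ , Sw , uw) deg≡1 with w ≟ v
  ... | yes w≡v = w≡v
  ... | no  w≢v = contradiction (begin
    1                                                  ≡⟨ cong ⟦_⟧ (sym uw) ⟩
    ⟦ adj G u w ⟧                                      ≤⟨ term≤sumOver (delete S u v) (λ x → ⟦ adj G u x ⟧)
                                                            (delete⁺ S Sw (edge-≢ f ∘ sym) w≢v) ⟩
    sumOver (delete S u v) (λ x → ⟦ adj G u x ⟧)       ≡⟨ suc-injective (trans (sym (deg-endpointˡ e)) deg≡1) ⟩
    0                                                  ∎) 1+n≰n
    where open ≤-Reasoning

  module _ (maxDeg : MaxDegreeAtMost G 3) where

    sum-lostDegree≤ : ∀ {S u v} → Edge G S u v →
                      sumOver (delete S u v) (lostDegree u v) ≤ suc (deg G S u)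
    sum-lostDegree≤ {S} {u} {v} e = ≤-pred (≤-pred (begin
      2 + sumOver (delete S u v) (lostDegree u v)  ≡⟨ sum-lostDegree e ⟩
      deg G S u + deg G S v                        ≤⟨ +-monoʳ-≤ (deg G S u) (≤-trans (deg≤deg-allV S v) (maxDeg v)) ⟩
      deg G S u + 3                                ≡⟨ +-comm (deg G S u) 3 ⟩
      3 + deg G S u                                ∎))
      where open ≤-Reasoning

    -- Summing `isOne-vanishes` bounds the leaves after the step plus twice the newly isolated nodes
    -- by the old leaves among the survivors plus 2 lost edge ends. The leaf `u` is not a survivor,
    -- so this is at most `leaves S + 1`.
    leaf-step : ∀ {S u v} → Edge G S u v → deg G S u ≡ 1 →
                newlyIsolated S u v + (leaves (delete S u v) ∸ 2) ≤ 1 + (leaves S ∸ 2)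
    leaf-step {S} {u} {v} e@(Su , Sv , _) deg≡1 = leaf-arithmetic I L′ (leaves S) (begin
      L′ + 2 * I
        ≡⟨ cong (L′ +_) (sym (sumOver-scale S′ 2 _)) ⟩
      L′ + sumOver S′ (λ w → 2 * vanishes (deg G S′ w) (lostDegree u v w))
        ≡⟨ sym (sumOver-+ S′ _ _) ⟩
      sumOver S′ (λ w → isOne (deg G S′ w) + 2 * vanishes (deg G S′ w) (lostDegree u v w))
        ≤⟨ sumOver-mono S′ _ _ (λ w _ → subst (λ δ → isOne (deg G S′ w) + 2 * vanishes (deg G S′ w) (lostDegree u v w) ≤ isOne δ + lostDegree u v w) (sym (deg-delete e w))
             (isOne-vanishes (deg G S′ w) (lostDegree u v w))) ⟩
      sumOver S′ (λ w → isOne (deg G S w) + lostDegree u v w)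
        ≡⟨ sumOver-+ S′ _ _ ⟩
      X + sumOver S′ (lostDegree u v)
        ≤⟨ +-monoʳ-≤ X (subst (λ δ → sumOver S′ (lostDegree u v) ≤ suc δ) deg≡1 (sum-lostDegree≤ e)) ⟩
      X + 2
        ≡⟨ +-comm X 2 ⟩
      suc (1 + X)
        ≤⟨ s≤s (+-monoˡ-≤ X (≤-trans (≤-reflexive (cong isOne (sym deg≡1))) (m≤m+n _ (isOne (deg G S v))))) ⟩
      suc (isOne (deg G S u) + isOne (deg G S v) + X)
        ≡⟨ cong suc (sym (sumOver-delete S Su Sv (edge-≢ e) _)) ⟩
      suc (leaves S) ∎)
      where
      open ≤-Reasoning
      S′ : VSet n
      S′ = delete S u v
      I L′ X : ℕ
      I = newlyIsolated S u v
      L′ = leaves S′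
      X = sumOver S′ (λ w → isOne (deg G S w))

    -- Of at most `3 + k` lost edge ends, isolating a survivor takes `2 + k` and producing a leaf
    -- takes `1 + k`. Three new leaves can arise at once, and `∸ 2` makes two of them free.
    nonleaf-step : ∀ {S u v k} → Edge G S u v → MinDegNonIsolated G S u → deg G S u ≡ 2 + k →
                   newlyIsolated S u v + (leaves (delete S u v) ∸ 2) ≤ 1
    nonleaf-step {S} {u} {v} {k} e min deg≡ = nonleaf-arithmetic k I L′
      (begin
        (2 + k) * I                        ≡⟨ sym (sumOver-scale S′ (2 + k) _) ⟩
        sumOver S′ (λ w → (2 + k) * vanishes (deg G S′ w) (lostDegree u v w))
          ≤⟨ sumOver-mono S′ _ _ (λ w S′w → vanishes-scaled (2 + k) (deg G S′ w) _ (large w S′w)) ⟩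
        sumOver S′ (lostDegree u v)        ≤⟨ C≤ ⟩
        3 + k                              ∎)
      (begin
        (1 + k) * (I + L′)                 ≡⟨ cong ((1 + k) *_) (sym (sumOver-+ S′ _ _)) ⟩
        (1 + k) * sumOver S′ (λ w → vanishes (deg G S′ w) (lostDegree u v w) + isOne (deg G S′ w))
          ≡⟨ sym (sumOver-scale S′ (1 + k) _) ⟩
        sumOver S′ (λ w → (1 + k) * (vanishes (deg G S′ w) (lostDegree u v w) + isOne (deg G S′ w)))
          ≤⟨ sumOver-mono S′ _ _ (λ w S′w → vanishes-isOne-scaled (1 + k) (deg G S′ w) _ (large w S′w)) ⟩
        sumOver S′ (lostDegree u v)        ≤⟨ C≤ ⟩
        3 + k                              ∎)
      where
      open ≤-Reasoning
      S′ : VSet n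
      S′ = delete S u v
      I L′ : ℕ
      I = newlyIsolated S u v
      L′ = leaves S′
      C≤ : sumOver S′ (lostDegree u v) ≤ 3 + k
      C≤ = subst (λ δ → sumOver S′ (lostDegree u v) ≤ suc δ) deg≡ (sum-lostDegree≤ e)
      large : ∀ w → S′ w ≡ true → 0 < deg G S′ w + lostDegree u v w →
              2 + k ≤ deg G S′ w + lostDegree u v w
      large w S′w 0<δ = subst₂ _≤_ deg≡ (deg-delete e w)
        (min w (proj₁ (delete⁻ S S′w)) (subst (0 <_) (sym (deg-delete e w)) 0<δ))

    -- Each step pays 2 for its endpoints and 1 for `change`. The term `leaves S ∸ 2` is a reserve
    -- for isolations still to come.
    nonIsolated≤ : ∀ {S M} → MinDegreeRun G S M → nonIsolated S ≤ 3 * length M + (leaves S ∸ 2)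
    -- Without edges all degrees are 0, where `positive` agrees with the degree, so the count equals
    -- the vanishing degree sum.
    nonIsolated≤ {S} (stop noE) = subst (_≤ leaves S ∸ 2)
      (sym (trans (sumOver-cong S _ (deg G S) (λ w Sw → trans (cong positive (noEdge⇒deg≡0 noE Sw)) (sym (noEdge⇒deg≡0 noE Sw))))
        (degreeSum-noEdge noE))) z≤n
    nonIsolated≤ {S} {_ ∷ M} (step u v e min run) = begin
      nonIsolated S                                ≤⟨ nonIsolated-delete e ⟩
      2 + (nonIsolated S′ + I)                     ≤⟨ +-monoʳ-≤ 2 (+-monoˡ-≤ I (nonIsolated≤ run)) ⟩
      2 + (3 * μ + (leaves S′ ∸ 2) + I)            ≡⟨ regroup (3 * μ) (leaves S′ ∸ 2) I ⟩
      2 + 3 * μ + (I + (leaves S′ ∸ 2))            ≤⟨ +-monoʳ-≤ (2 + 3 * μ) change ⟩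
      2 + 3 * μ + (1 + (leaves S ∸ 2))             ≡⟨ collect μ (leaves S ∸ 2) ⟩
      3 * suc μ + (leaves S ∸ 2)                   ∎
      where
      open ≤-Reasoning
      S′ : VSet n
      S′ = delete S u v
      I μ : ℕ
      I = newlyIsolated S u v
      μ = length M
      regroup : ∀ a b c → 2 + (a + b + c) ≡ 2 + a + (c + b)
      regroup = solve-∀
      collect : ∀ m a → 2 + 3 * m + (1 + a) ≡ 3 * suc m + a
      collect = solve-∀
      change : I + (leaves S′ ∸ 2) ≤ 1 + (leaves S ∸ 2)
      change with one-or-more (deg G S u) (edge⇒deg>0 e)
      ... | inj₁ deg≡1      = leaf-step e deg≡1
      ... | inj₂ (_ , deg≡) = ≤-trans (nonleaf-step e min deg≡) (m≤m+n 1 _)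

    -- Fractional vertex covers built from greedy runs.

    Cover : VSet n → (Fin n → ℕ) → Set
    Cover S y = ∀ a b → Edge G S a b → 2 ≤ y a + y b

    -- Weights count halves, so 2 at `v` covers every edge at `v` outright. The only edge at the
    -- leaf `u` goes to `v`, so all remaining edges survive the deletion.
    leaf-cover : ∀ {S u v y} → Edge G S u v → deg G S u ≡ 1 → Cover (delete S u v) y →
                 Cover S (λ w → if ⌊ w ≟ v ⌋ then 2 else y w)
    leaf-cover {S} {u} {v} {y} e deg≡1 cover a b ab with a ≟ v | b ≟ v
    ... | yes _  | _      = m≤m+n 2 _
    ... | no _   | yes _  = m≤n+m 2 (y a)
    ... | no a≢v | no b≢v = cover a b
      ( delete⁺ S (proj₁ ab) (λ { refl → b≢v (leaf-neighbour e ab deg≡1) }) a≢v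
      , delete⁺ S (proj₁ (proj₂ ab)) (λ { refl → a≢v (leaf-neighbour e (edge-sym ab) deg≡1) }) b≢v
      , proj₂ (proj₂ ab))

    sum-override : (y : Fin n → ℕ) (v : Fin n) → sum (λ w → if ⌊ w ≟ v ⌋ then 2 else y w) ≤ 2 + sum y
    sum-override y v = begin
      sum y′                     ≡⟨ sum-extract y′ v ⟩
      y′ v + sum (y′ without v)  ≤⟨ +-mono-≤ y′v≤2 (sum-mono (y′ without v) y pointwise) ⟩
      2 + sum y                  ∎
      where
      open ≤-Reasoning
      y′ : Fin n → ℕ
      y′ w = if ⌊ w ≟ v ⌋ then 2 else y w
      y′v≤2 : y′ v ≤ 2
      y′v≤2 with v ≟ v
      ... | yes _  = ≤-refl
      ... | no v≢v = contradiction refl v≢v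
      pointwise : ∀ w → (y′ without v) w ≤ y w
      pointwise w with w ≟ v
      ... | yes _ = z≤n
      ... | no _  = ≤-refl

    -- A leaf step adds at most 2, within the allowance of 3. At the first step of degree at least 2
    -- the recursion ends: the whole current graph is covered at once, and `nonIsolated≤` bounds the
    -- weight.
    run-cover : ∀ {S M} → MinDegreeRun G S M → ∃[ y ] Cover S y × sum y ≤ 3 * length M
    run-cover (stop noE) = (λ _ → 0)
      , (λ { a b (Sa , Sb , ab) → contradiction (trans (sym ab) (noE a b Sa Sb)) λ () })
      , ≤-reflexive (sum-zero {n} (λ _ → 0) (λ _ → refl))
    run-cover {S} {_ ∷ M} (step u v e min run) with one-or-more (deg G S u) (edge⇒deg>0 e)
    ... | inj₁ deg≡1 with run-cover run
    ...   | y , cover , ∑y≤ = _ , leaf-cover e deg≡1 cover , (begin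
      sum (λ w → if ⌊ w ≟ v ⌋ then 2 else y w)  ≤⟨ sum-override y v ⟩
      2 + sum y                                 ≤⟨ +-mono-≤ (n≤1+n 2) ∑y≤ ⟩
      3 + 3 * length M                          ≡⟨ sym (*-suc 3 (length M)) ⟩
      3 * suc (length M)                        ∎)
      where open ≤-Reasoning
    run-cover {S} {_ ∷ M} r@(step u v e min run) | inj₂ (k , deg≡) =
        -- Weight 0 outside `S` makes the total over all nodes equal to `nonIsolated S` by
        -- definition.
        (λ w → if S w then positive (deg G S w) else 0)
      , (λ a b ab → +-mono-≤ (weight≥1 ab) (weight≥1 (edge-sym ab)))
      , subst (nonIsolated S ≤_) (trans (cong (λ ℓ → 3 * suc (length M) + (ℓ ∸ 2)) noLeaves) (+-identityʳ _)) (nonIsolated≤ r)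
      where
      weight≥1 : ∀ {a b} → Edge G S a b → 1 ≤ (if S a then positive (deg G S a) else 0)
      weight≥1 {a} ab rewrite proj₁ ab = positive≥1 (edge⇒deg>0 ab)
      -- A leaf would undercut the minimum degree `2 + k`; hence the term `leaves S ∸ 2` vanishes.
      noLeaves : leaves S ≡ 0
      noLeaves = n≤0⇒n≡0 (≮⇒≥ λ 0<ℓ →
        let w , Sw , 0<isOne = sumOver-positive S _ 0<ℓ
            deg≡1 = isOne⇒≡1 (deg G S w) 0<isOne
        in contradiction (subst₂ _≤_ deg≡ deg≡1 (min w Sw (subst (0 <_) (sym deg≡1) z<s))) λ { (s≤s ()) })

theorem3 : (Δ n : ℕ) → (G : Graph n) →
    3 ≤ Δ →
    ((Δ ≡ 3 × MaxDegreeAtMost G 3) ⊎ (4 ≤ Δ × Regular G Δ)) →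
    (M N : List (Fin n × Fin n)) →
    MinDegreeRun G allV M →
    IsMaximumMatching G N →
    (Δ ∸ 1) * length N ≤ (2 * Δ ∸ 3) * length M
-- For `Δ = 3` the coefficients compute to 2 and 3, so weak duality and the weight bound of
-- `run-cover` chain directly.
theorem3 .3 n G _ (inj₁ (refl , maxDeg)) M N run (matching , _) with run-cover G maxDeg run
... | y , cover , ∑y≤ = ≤-trans (matching≤cover G y (λ u v uv → cover u v (refl , refl , uv)) N matching) ∑y≤
theorem3 (suc d) n G (s≤s 2≤d) (inj₂ (_ , reg)) M N run (matching , _) =
  regular-bound G d 2≤d reg M N run matching
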